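{- Let $\alpha\in\mathbb{N}$, let $m$ be a positive odd integer with $m>6\alpha+2$, and let $\mathbb{S}=\langle 6,6\alpha+2,m\rangle$. Define $\beta_1=6\,x_1$, $\beta_2=(6\alpha+2)\,x_2$, $\beta_3=m\,x_3$, where $x_1=\min\{x\ge1:6x\in\langle 6\alpha+2,m\rangle\}$, $x_2=\min\{x\ge1:(6\alpha+2)x\in\langle 6,m\rangle\}$, $x_3=\min\{x\ge1:mx\in\langle 6,6\alpha+2\rangle\}$. Factorizations are taken with respect to $(6,6\alpha+2,m)$. Then: (i) If $6\alpha+2<m\le 9\alpha+3$ and $3\mid m$, then $\beta_1=2m$ and its factorizations are $(0,0,2)$ and $\left(\frac{m-k(3\alpha+1)}{3},k,0\right)$ for $k\in\mathbb{N}$ with $k\le\frac{m}{3\alpha+1}$ and $3\mid m-k(3\alpha+1)$. Otherwise, $\beta_1=18\alpha+6$ and its factorizations are $(3\alpha+1,0,0)$ and $(0,3,0)$. (ii) $\beta_2=18\alpha+6$. If $6\alpha+2<m\le 9\alpha+3$ and $3\mid m$, then its factorizations are $\left(\frac{9\alpha+3-m}{3},0,2\right)$, $(3\alpha+1,0,0)$ and $(0,3,0)$. Otherwise, its factorizations are $(3\alpha+1,0,0)$ and $(0,3,0)$. (iii) $\beta_3=2m$ and its factorizations are $(0,0,2)$ and $\left(\frac{m-k(3\alpha+1)}{3},k,0\right)$ for $k\in\mathbb{N}$ with $k\le\frac{m}{3\alpha+1}$ and $3\mid m-k(3\alpha+1)$.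
   Context: $\mathbb{N}=\{0,1,2,\dots\}$. $\langle a_1,\dots,a_e\rangle$ is the set of $\mathbb{N}$-linear combinations of $a_1,\dots,a_e$. A factorization of $a\in\langle a_1,a_2,a_3\rangle$ is a tuple $(\eta_1,\eta_2,\eta_3)\in\mathbb{N}^3$ with $\eta_1a_1+\eta_2a_2+\eta_3a_3=a$. -}

module Defs where

open import Data.Nat using (ℕ; _+_; _*_; _∸_; _/_; _≤_; _<_)
open import Data.Nat.Divisibility using (_∣_)
open import Data.Product using (_×_; ∃)
open import Data.Vec using (Vec; []; _∷_; sum; zipWith)
open import Level using (0ℓ)
open import Relation.Binary.PropositionalEquality using (_≡_)
open import Relation.Unary using (Pred; _∈_; _∪_; ｛_｝)

⟨_⟩ : ∀ {e} → Vec ℕ e → Pred ℕ 0ℓ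
⟨ as ⟩ a = ∃ λ η → sum (zipWith _*_ η as) ≡ a

Factorizations : ∀ {e} → Vec ℕ e → ℕ → Pred (Vec ℕ e) 0ℓ
Factorizations as a η = sum (zipWith _*_ η as) ≡ a

IsMin : Pred ℕ 0ℓ → Pred ℕ 0ℓ
IsMin P x = x ∈ P × (∀ {y} → y ∈ P → x ≤ y)

-- x = min { x ≥ 1 : a x ∈ ⟨ as ⟩ }
IsMinMultiplier : ∀ {e} → ℕ → Vec ℕ e → Pred ℕ 0ℓ
IsMinMultiplier a as = IsMin (λ x → 1 ≤ x × a * x ∈ ⟨ as ⟩)

Exceptional : ℕ → ℕ → Set
Exceptional α m = 6 * α + 2 < m × m ≤ 9 * α + 3 × 3 ∣ m

-- The bound k ≤ m / (3α + 1) on rationals is stated with the denominator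
-- cleared; it makes the truncated subtraction exact, and the divisibility
-- condition makes the division by 3 exact.
Family : ℕ → ℕ → Pred (Vec ℕ 3) 0ℓ
Family α m η = ∃ λ k →
    k * (3 * α + 1) ≤ m
  × 3 ∣ (m ∸ k * (3 * α + 1))
  × η ≡ (m ∸ k * (3 * α + 1)) / 3 ∷ k ∷ 0 ∷ []

DoubleGenerator : ℕ → ℕ → Pred (Vec ℕ 3) 0ℓ
DoubleGenerator α m = ｛ 0 ∷ 0 ∷ 2 ∷ [] ｝ ∪ Family α m

TwoPoints : ℕ → Pred (Vec ℕ 3) 0ℓ
TwoPoints α = ｛ 3 * α + 1 ∷ 0 ∷ 0 ∷ [] ｝ ∪ ｛ 0 ∷ 3 ∷ 0 ∷ [] ｝

-- Used only when m ≤ 9α + 3 and 3 ∣ m, so ∸ and / are exact.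
ThreePoints : ℕ → ℕ → Pred (Vec ℕ 3) 0ℓ
ThreePoints α m = ｛ (9 * α + 3 ∸ m) / 3 ∷ 0 ∷ 2 ∷ [] ｝ ∪ TwoPoints α

{-# OPTIONS --safe #-}
module Submission where

open import Defs
open import Data.Nat using (ℕ; suc; _+_; _*_; _∸_; _/_; _≤_; _<_; z≤n; s≤s; >-nonZero)
open import Data.Nat.Properties
open import Data.Nat.Divisibility
open import Data.Nat.DivMod using (_%_; m*n/n≡m; m*[n/m]≡n; m%n<n; m≡m%n+[m/n]*n; /-monoˡ-≤)
open import Data.Nat.Primality using (prime[2]; euclidsLemma)
open import Data.Nat.Tactic.RingSolver using (solve-∀)
open import Data.Product using (_×_; _,_; ∃; proj₂)
open import Data.Sum using (_⊎_; inj₁; inj₂)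
open import Data.Vec using ([]; _∷_)
open import Level using (0ℓ)
open import Relation.Binary.PropositionalEquality
  using (_≡_; refl; sym; trans; cong; subst; module ≡-Reasoning)
open import Relation.Nullary using (¬_; contradiction)
open import Relation.Unary using (Pred; _∈_; _≐_)

-- Since m is odd, its coefficient in any representation of an even number is
-- even, so every equation can be halved.  With n = 3α + 1 the generators become
-- 3, n, m, where n ≡ 1 (mod 3) and m > 2n.  The equations for 3n and for m then
-- have very few solutions: two copies of m, or one copy of n together with one
-- of m, already exceed 3n.

-- Lets the given `x₁`, `x₂`, `x₃` be replaced by explicit values, once those are shown to be
-- minimal.
IsMin-unique : ∀ {P : Pred ℕ 0ℓ} {x y} → IsMin P x → IsMin P y → x ≡ y
IsMin-unique (x∈P , x≤) (y∈P , y≤) = ≤-antisym (x≤ y∈P) (y≤ x∈P)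

-- Here `u` collects half the contribution of the even generators. The product `r * m` is even, so
-- Euclid's lemma at the prime 2 puts the factor 2 into `r`.
halve : ∀ {m} → ¬ (2 ∣ m) → ∀ u r b → 2 * u + r * m ≡ 2 * b →
        ∃ λ c → r ≡ c * 2 × u + c * m ≡ b
halve {m} odd u r b eq with euclidsLemma r m prime[2]
  (∣m+n∣m⇒∣n (subst (2 ∣_) (sym eq) (m∣m*n b)) (m∣m*n u))
... | inj₂ 2∣m = contradiction 2∣m odd
... | inj₁ (divides c refl) =
  c , refl , *-cancelˡ-≡ (u + c * m) b 2 (trans (double u c m) eq)
  where
  double : ∀ u c m → 2 * (u + c * m) ≡ 2 * u + c * 2 * m
  double = solve-∀

-- Brings the first coordinate of a solution into the quotient form used in `Family` and
-- `ThreePoints`; `third-exact` goes back.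
third : ∀ p k b → 3 * p + k ≡ b → (b ∸ k) / 3 ≡ p
third p k _ refl = trans (cong (_/ 3) (trans (m+n∸n≡m (3 * p) k) (*-comm 3 p))) (m*n/n≡m p 3)

third-exact : ∀ {k b} → k ≤ b → 3 ∣ b ∸ k → 3 * ((b ∸ k) / 3) + k ≡ b
third-exact {k} k≤b 3∣b∸k = trans (cong (_+ k) (m*[n/m]≡n 3∣b∸k)) (m∸n+n≡m k≤b)

-- Equations in the halved generators 3 and `n`.

module _ (α : ℕ) where

  private
    n : ℕ
    n = 3 * α + 1

  0<n : 0 < n
  0<n = m≤n+m 1 (3 * α)

  second-generator : 6 * α + 2 ≡ 2 * n
  second-generator = lemma α
    where
    lemma : ∀ α → 6 * α + 2 ≡ 2 * (3 * α + 1)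
    lemma = solve-∀

  -- Since `n` is 1 modulo 3, the left side is congruent to `q`.
  3∣coefficient : ∀ p q b → 3 * p + q * n ≡ 3 * b → 3 ∣ q
  3∣coefficient p q b eq = ∣m+n∣m⇒∣n
    (subst (3 ∣_) (trans (sym eq) (regroup α p q)) (m∣m*n b)) (m∣m*n (p + q * α))
    where
    regroup : ∀ α p q → 3 * p + q * (3 * α + 1) ≡ 3 * (p + q * α) + q
    regroup = solve-∀

  -- Writing q = 3k and cancelling 3 leaves p + kn = n, which allows only k = 0 and k = 1 because n
  -- is positive.
  solutions-3n : ∀ p q → 3 * p + q * n ≡ 3 * n → (p ≡ n × q ≡ 0) ⊎ (p ≡ 0 × q ≡ 3)
  solutions-3n p q eq with 3∣coefficient p q n eq
  ... | divides k refl = go k (*-cancelˡ-≡ (p + k * n) n 3 (trans (triple p k n) eq))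
    where
    triple : ∀ p k n → 3 * (p + k * n) ≡ 3 * p + k * 3 * n
    triple = solve-∀
    go : ∀ k → p + k * n ≡ n → (p ≡ n × k * 3 ≡ 0) ⊎ (p ≡ 0 × k * 3 ≡ 3)
    go 0 e = inj₁ (trans (sym (+-identityʳ p)) e , refl)
    go 1 e = inj₂ (+-cancelʳ-≡ n p 0 (trans (cong (p +_) (sym (+-identityʳ n))) e) , refl)
    go (suc (suc k)) e = contradiction e (>⇒≢ (begin-strict
      n                     <⟨ m<m+n n 0<n ⟩
      n + n                 ≤⟨ +-monoʳ-≤ n (m≤m+n n (k * n)) ⟩
      n + (n + k * n)       ≤⟨ m≤n+m _ p ⟩
      p + (n + (n + k * n)) ∎))
      where open ≤-Reasoning

  module Generators {m : ℕ} (odd : ¬ (2 ∣ m)) (2n<m : 2 * n < m) where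

    3n<n+m : 3 * n < n + m
    3n<n+m = +-monoʳ-< n 2n<m

    3n<2m : 3 * n < m + m
    3n<2m = <-trans 3n<n+m (+-monoˡ-< m (≤-<-trans (m≤m+n n _) 2n<m))

    F : ℕ → Pred _ 0ℓ
    F = Factorizations (6 ∷ 6 * α + 2 ∷ m ∷ [])

    -- The weights 3, `n`, `m` are half of 6, `6 * α + 2` and `2 * m`, so `c` counts pairs of copies
    -- of `m`.
    Halved : ℕ → ℕ → ℕ → ℕ → Set
    Halved b p q r = ∃ λ c → r ≡ c * 2 × 3 * p + q * n + c * m ≡ b

    halve-F : ∀ b p q r → F (2 * b) (p ∷ q ∷ r ∷ []) → Halved b p q r
    halve-F b p q r eq =
      halve odd (3 * p + q * n) r b (trans (regroup α m p q r) eq)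
      where
      regroup : ∀ α m p q r → 2 * (3 * p + q * (3 * α + 1)) + r * m
                ≡ p * 6 + (q * (6 * α + 2) + (r * m + 0))
      regroup = solve-∀

    double-F : ∀ {b} p q c → 3 * p + q * n + c * m ≡ b →
               F (2 * b) (p ∷ q ∷ c * 2 ∷ [])
    double-F p q c eq = trans (regroup α m p q c) (cong (2 *_) eq)
      where
      regroup : ∀ α m p q c → p * 6 + (q * (6 * α + 2) + (c * 2 * m + 0))
                ≡ 2 * (3 * p + q * (3 * α + 1) + c * m)
      regroup = solve-∀

    -- Factorizations of 6n = 18α + 6.

    TwoPoints⊆F : ∀ {η} → TwoPoints α η → F (2 * (3 * n)) η
    TwoPoints⊆F (inj₁ refl) =
      double-F n 0 0 (trans (+-identityʳ _) (+-identityʳ _))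
    TwoPoints⊆F (inj₂ refl) = double-F 0 3 0 (+-identityʳ _)

    -- No pair of `m` reduces to `solutions-3n`. One pair forces q = 0, as n + m exceeds 3n, and two
    -- pairs are too large. The equation left in the last alternative is solvable exactly when m is
    -- a multiple of 3 with m ≤ 3n, which is the exceptional case.
    F-3n : ∀ p q r → F (2 * (3 * n)) (p ∷ q ∷ r ∷ []) →
           TwoPoints α (p ∷ q ∷ r ∷ []) ⊎ (q ≡ 0 × r ≡ 2 × 3 * p + m ≡ 3 * n)
    F-3n p q r f with halve-F (3 * n) p q r f
    ... | 0 , refl , eq with solutions-3n p q (trans (sym (+-identityʳ _)) eq)
    ...   | inj₁ (refl , refl) = inj₁ (inj₁ refl)
    ...   | inj₂ (refl , refl) = inj₁ (inj₂ refl)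
    F-3n p 0 r f | 1 , refl , eq = inj₂ (refl , refl , trans (tidy p m) eq)
      where
      tidy : ∀ p m → 3 * p + m ≡ 3 * p + 0 + 1 * m
      tidy = solve-∀
    F-3n p (suc q) r f | 1 , refl , eq = contradiction eq (>⇒≢ (begin-strict
      3 * n                           <⟨ 3n<n+m ⟩
      n + m                           ≤⟨ +-monoˡ-≤ m (m≤m+n n (q * n)) ⟩
      suc q * n + m                   ≤⟨ +-mono-≤ (m≤n+m _ (3 * p)) (m≤m+n m 0) ⟩
      3 * p + suc q * n + 1 * m       ∎))
      where open ≤-Reasoning
    F-3n p q r f | suc (suc c) , refl , eq = contradiction eq (>⇒≢ (begin-strict
      3 * n                               <⟨ 3n<2m ⟩
      m + m                               ≤⟨ +-monoʳ-≤ m (m≤m+n m (c * m)) ⟩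
      suc (suc c) * m                     ≤⟨ m≤n+m _ (3 * p + q * n) ⟩
      3 * p + q * n + suc (suc c) * m     ∎))
      where open ≤-Reasoning

    9α+3≡3n : 9 * α + 3 ≡ 3 * n
    9α+3≡3n = lemma α
      where
      lemma : ∀ α → 9 * α + 3 ≡ 3 * (3 * α + 1)
      lemma = solve-∀

    exceptional : m ≤ 3 * n → 3 ∣ m → Exceptional α m
    exceptional m≤3n 3∣m =
      subst (_< m) (sym second-generator) 2n<m , subst (m ≤_) (sym 9α+3≡3n) m≤3n , 3∣m

    F-3n-generic : ¬ Exceptional α m → F (2 * (3 * n)) ≐ TwoPoints α
    F-3n-generic ¬exc = to , TwoPoints⊆F
      where
      to : ∀ {η} → F (2 * (3 * n)) η → TwoPoints α η
      to {p ∷ q ∷ r ∷ []} f with F-3n p q r f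
      ... | inj₁ t = t
      ... | inj₂ (_ , _ , eq) = contradiction
        (exceptional (subst (m ≤_) eq (m≤n+m m (3 * p)))
                     (∣m+n∣m⇒∣n (subst (3 ∣_) (sym eq) (m∣m*n n)) (m∣m*n p))) ¬exc

    F-3n-exceptional : Exceptional α m → F (2 * (3 * n)) ≐ ThreePoints α m
    F-3n-exceptional (_ , m≤9α+3 , 3∣m) = to , from
      where
      to : ∀ {η} → F (2 * (3 * n)) η → ThreePoints α m η
      to {p ∷ q ∷ r ∷ []} f with F-3n p q r f
      ... | inj₁ t = inj₂ t
      ... | inj₂ (refl , refl , eq) =
        inj₁ (cong (_∷ 0 ∷ 2 ∷ []) (third p m _ (trans eq (sym 9α+3≡3n))))

      3∣9α+3 : 3 ∣ 9 * α + 3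
      3∣9α+3 = subst (3 ∣_) (sym 9α+3≡3n) (m∣m*n n)

      from : ∀ {η} → ThreePoints α m η → F (2 * (3 * n)) η
      from (inj₂ t) = TwoPoints⊆F t
      from (inj₁ refl) = double-F p 0 1 (begin
        3 * p + 0 + 1 * m ≡⟨ tidy p m ⟩
        3 * p + m         ≡⟨ third-exact m≤9α+3 (3∣9α+3∸m) ⟩
        9 * α + 3         ≡⟨ 9α+3≡3n ⟩
        3 * n             ∎)
        where
        open ≡-Reasoning
        p : ℕ
        p = (9 * α + 3 ∸ m) / 3
        tidy : ∀ p m → 3 * p + 0 + 1 * m ≡ 3 * p + m
        tidy = solve-∀
        3∣9α+3∸m : 3 ∣ 9 * α + 3 ∸ m
        3∣9α+3∸m = ∣m+n∣m⇒∣n (subst (3 ∣_) (sym (m+[n∸m]≡n m≤9α+3)) 3∣9α+3) 3∣m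

    -- Factorizations of 2m.

    -- The halved equation is 3p + qn + cm = m. For c = 0 it describes the family with k = q, for c
    -- = 1 it leaves 3p + qn = 0, and c ≥ 2 exceeds m.
    F-2m : F (2 * m) ≐ DoubleGenerator α m
    F-2m = to , from
      where
      to : ∀ {η} → F (2 * m) η → DoubleGenerator α m η
      to {p ∷ q ∷ r ∷ []} f with halve-F m p q r f
      ... | 0 , refl , eq = inj₂
        ( q
        , subst (q * n ≤_) eq′ (m≤n+m (q * n) (3 * p))
        , subst (3 ∣_) 3p≡ (m∣m*n p)
        , cong (_∷ q ∷ 0 ∷ []) (sym (third p (q * n) m eq′)) )
        where
        eq′ : 3 * p + q * n ≡ m
        eq′ = trans (sym (+-identityʳ _)) eq
        3p≡ : 3 * p ≡ m ∸ q * n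
        3p≡ = trans (sym (m+n∸n≡m (3 * p) (q * n))) (cong (_∸ q * n) eq′)
      ... | 1 , refl , eq = inj₁ (sym (vanish p q (+-cancelʳ-≡ m _ 0
              (trans (cong (3 * p + q * n +_) (sym (*-identityˡ m))) eq))))
        where
        vanish : ∀ p q → 3 * p + q * n ≡ 0 → p ∷ q ∷ 2 ∷ [] ≡ 0 ∷ 0 ∷ 2 ∷ []
        -- A successor `p` turns the left side into a successor, so that case needs no clause.
        vanish 0 0 _ = refl
        vanish 0 (suc q) e = contradiction (m+n≡0⇒m≡0 n e) (>⇒≢ 0<n)
      ... | suc (suc c) , refl , eq = contradiction eq (>⇒≢ (begin-strict
        m                               <⟨ m<m+n m (≤-<-trans z≤n 2n<m) ⟩
        m + m                           ≤⟨ +-monoʳ-≤ m (m≤m+n m (c * m)) ⟩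
        suc (suc c) * m                 ≤⟨ m≤n+m _ (3 * p + q * n) ⟩
        3 * p + q * n + suc (suc c) * m ∎))
        where open ≤-Reasoning

      from : ∀ {η} → DoubleGenerator α m η → F (2 * m) η
      from (inj₁ refl) = double-F 0 0 1 (*-identityˡ m)
      from (inj₂ (k , kn≤m , 3∣ , refl)) =
        double-F ((m ∸ k * n) / 3) k 0 (trans (+-identityʳ _) (third-exact kn≤m 3∣))

    -- The minimal multipliers.

    -- Supplies the lower bound for `x₁` in both cases. Halving gives an + cm = 3y. If c = 0, then a
    -- is a positive multiple of 3, so 3n ≤ 3y. If c = 1 and a = 0, then m = 3y. Otherwise n + m or
    -- 2m is at most 3y, and both exceed 3n.
    6-multiple : ∀ y → 1 ≤ y → 6 * y ∈ ⟨ 6 * α + 2 ∷ m ∷ [] ⟩ → n ≤ y ⊎ 3 * y ≡ m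
    6-multiple y 1≤y (a ∷ b ∷ [] , eq)
      with halve odd (a * n) b (3 * y) (trans (regroup α m a b) (trans eq (*-assoc 2 3 y)))
      where
      regroup : ∀ α m a b → 2 * (a * (3 * α + 1)) + b * m ≡ a * (6 * α + 2) + (b * m + 0)
      regroup = solve-∀
    ... | 0 , refl , e with 3∣coefficient 0 a y (trans (sym (+-identityʳ _)) e)
    ...   | divides k refl = inj₁ (*-cancelˡ-≤ 3 (go k e))
      where
      open ≤-Reasoning
      go : ∀ k → k * 3 * n + 0 ≡ 3 * y → 3 * n ≤ 3 * y
      go 0 e = contradiction e (<⇒≢ (*-monoʳ-< 3 1≤y))
      go (suc k) e = begin
        3 * n                ≤⟨ *-monoˡ-≤ n (m≤m+n 3 (k * 3)) ⟩
        suc k * 3 * n        ≡⟨ +-identityʳ _ ⟨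
        suc k * 3 * n + 0    ≡⟨ e ⟩
        3 * y                ∎
    6-multiple y 1≤y (0 ∷ b ∷ [] , eq) | 1 , refl , e =
      inj₂ (trans (sym e) (*-identityˡ m))
    6-multiple y 1≤y (suc a ∷ b ∷ [] , eq) | 1 , refl , e =
      inj₁ (*-cancelˡ-≤ 3 (begin
        3 * n                ≤⟨ <⇒≤ 3n<n+m ⟩
        n + m                ≤⟨ +-mono-≤ (m≤m+n n (a * n)) (m≤m+n m 0) ⟩
        suc a * n + 1 * m    ≡⟨ e ⟩
        3 * y                ∎))
      where open ≤-Reasoning
    6-multiple y 1≤y (a ∷ b ∷ [] , eq) | suc (suc c) , refl , e =
      inj₁ (*-cancelˡ-≤ 3 (begin
        3 * n                       ≤⟨ <⇒≤ 3n<2m ⟩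
        m + m                       ≤⟨ +-monoʳ-≤ m (m≤m+n m (c * m)) ⟩
        suc (suc c) * m             ≤⟨ m≤n+m _ (a * n) ⟩
        a * n + suc (suc c) * m     ≡⟨ e ⟩
        3 * y                       ∎))
      where open ≤-Reasoning

    multiplier₁-generic : ¬ Exceptional α m → IsMinMultiplier 6 (6 * α + 2 ∷ m ∷ []) n
    multiplier₁-generic ¬exc = (0<n , 3 ∷ 0 ∷ [] , member α) , least
      where
      member : ∀ α → 3 * (6 * α + 2) + 0 ≡ 6 * (3 * α + 1)
      member = solve-∀
      least : ∀ {y} → 1 ≤ y × 6 * y ∈ ⟨ 6 * α + 2 ∷ m ∷ [] ⟩ → n ≤ y
      least {y} (1≤y , mem) with 6-multiple y 1≤y mem
      ... | inj₁ n≤y = n≤y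
      -- With y < n, the number m = 3y would be a multiple of 3 below 3n, hence exceptional.
      ... | inj₂ eq = ≮⇒≥ λ y<n → ¬exc
        (exceptional (subst (_≤ 3 * n) eq (*-monoʳ-≤ 3 (<⇒≤ y<n)))
                     (subst (3 ∣_) eq (m∣m*n y)))

    -- The relation is 6t = 2m. Since 3t = m ≤ 3n, also t ≤ n, so `t` is a lower bound in both
    -- alternatives of `6-multiple`.
    multiplier₁-exceptional : ∀ t → m ≡ t * 3 → m ≤ 9 * α + 3 →
                              IsMinMultiplier 6 (6 * α + 2 ∷ m ∷ []) t
    multiplier₁-exceptional t m≡t*3 m≤9α+3 =
      (0<t t m≡t*3 , 0 ∷ 2 ∷ [] , trans (cong (λ m → 2 * m + 0) m≡t*3) (member t)) , least
      where
      0<t : ∀ t → m ≡ t * 3 → 0 < t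
      0<t 0 e = contradiction e (>⇒≢ (≤-<-trans z≤n 2n<m))
      0<t (suc _) _ = s≤s z≤n
      member : ∀ t → 2 * (t * 3) + 0 ≡ 6 * t
      member = solve-∀
      m≡3t : m ≡ 3 * t
      m≡3t = trans m≡t*3 (*-comm t 3)
      least : ∀ {y} → 1 ≤ y × 6 * y ∈ ⟨ 6 * α + 2 ∷ m ∷ [] ⟩ → t ≤ y
      least {y} (1≤y , mem) with 6-multiple y 1≤y mem
      ... | inj₁ n≤y =
        ≤-trans (*-cancelˡ-≤ 3 (subst (_≤ 3 * n) m≡3t (subst (m ≤_) 9α+3≡3n m≤9α+3))) n≤y
      ... | inj₂ eq = ≤-reflexive (*-cancelˡ-≡ t y 3 (trans (sym m≡3t) (sym eq)))

    -- Halving a representation of (6α + 2)y gives 3a + cm = yn. If c = 0, then 3 divides y;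
    -- otherwise 2n < m ≤ yn, so y > 2.
    multiplier₂ : IsMinMultiplier (6 * α + 2) (6 ∷ m ∷ []) 3
    multiplier₂ = (s≤s z≤n , n ∷ 0 ∷ [] , member α) , least
      where
      member : ∀ α → (3 * α + 1) * 6 + 0 ≡ (6 * α + 2) * 3
      member = solve-∀
      least : ∀ {y} → 1 ≤ y × (6 * α + 2) * y ∈ ⟨ 6 ∷ m ∷ [] ⟩ → 3 ≤ y
      least {y} (1≤y , a ∷ b ∷ [] , eq)
        with halve odd (3 * a) b (y * n) (trans (regroup m a b) (trans eq (double α y)))
        where
        regroup : ∀ m a b → 2 * (3 * a) + b * m ≡ a * 6 + (b * m + 0)
        regroup = solve-∀
        double : ∀ α y → (6 * α + 2) * y ≡ 2 * (y * (3 * α + 1))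
        double = solve-∀
      ... | 0 , _ , e = ∣⇒≤ ⦃ >-nonZero 1≤y ⦄
        (3∣coefficient 0 y a (trans (sym e) (+-identityʳ _)))
      ... | suc c , _ , e = *-cancelʳ-< n 2 y (begin-strict
        2 * n               <⟨ 2n<m ⟩
        m                   ≤⟨ m≤m+n m (c * m) ⟩
        suc c * m           ≤⟨ m≤n+m _ (3 * a) ⟩
        3 * a + suc c * m   ≡⟨ e ⟩
        y * n               ∎)
        where open ≤-Reasoning

    multiplier₃ : IsMinMultiplier m (6 ∷ 6 * α + 2 ∷ []) 2
    multiplier₃ = (s≤s z≤n , p ∷ k ∷ [] , member) , least
      where
      -- k = m mod 3 copies of n leave a multiple of 3, as n ≡ 1 (mod 3).
      k p : ℕ
      k = m % 3
      p = m / 3 ∸ α * k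
      -- Makes the truncated subtraction in `p` exact: k ≤ 2 and 6α ≤ m.
      αk≤m/3 : α * k ≤ m / 3
      αk≤m/3 = begin
        α * k           ≤⟨ *-monoʳ-≤ α (≤-pred (m%n<n m 3)) ⟩
        α * 2           ≡⟨ m*n/n≡m (α * 2) 3 ⟨
        α * 2 * 3 / 3   ≤⟨ /-monoˡ-≤ 3 (begin
          α * 2 * 3       ≡⟨ *-assoc α 2 3 ⟩
          α * 6           ≡⟨ *-comm α 6 ⟩
          6 * α           ≤⟨ m≤m+n (6 * α) 2 ⟩
          6 * α + 2       ≡⟨ second-generator ⟩
          2 * n           ≤⟨ <⇒≤ 2n<m ⟩
          m               ∎) ⟩
        m / 3           ∎
        where open ≤-Reasoning
      member : p * 6 + (k * (6 * α + 2) + 0) ≡ m * 2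
      member = begin
        p * 6 + (k * (6 * α + 2) + 0)   ≡⟨ regroup α p k ⟩
        (k + (p + α * k) * 3) * 2       ≡⟨ cong (λ t → (k + t * 3) * 2) (m∸n+n≡m αk≤m/3) ⟩
        (k + m / 3 * 3) * 2             ≡⟨ cong (_* 2) (m≡m%n+[m/n]*n m 3) ⟨
        m * 2                           ∎
        where
        open ≡-Reasoning
        regroup : ∀ α p k → p * 6 + (k * (6 * α + 2) + 0) ≡ (k + (p + α * k) * 3) * 2
        regroup = solve-∀
      least : ∀ {y} → 1 ≤ y × m * y ∈ ⟨ 6 ∷ 6 * α + 2 ∷ [] ⟩ → 2 ≤ y
      -- Both generators here are even, so halving with `u` = 0 shows that y itself is even.
      least {y} (1≤y , a ∷ b ∷ [] , eq)
        with halve odd 0 y (3 * a + b * n)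
               (trans (*-comm y m) (trans (sym eq) (regroup α a b)))
        where
        regroup : ∀ α a b → a * 6 + (b * (6 * α + 2) + 0) ≡ 2 * (3 * a + b * (3 * α + 1))
        regroup = solve-∀
      ... | c , y≡c*2 , _ = ∣⇒≤ ⦃ >-nonZero 1≤y ⦄ (divides c y≡c*2)

theorem7 : ∀ (α m : ℕ) → 0 < m → ¬ (2 ∣ m) → 6 * α + 2 < m →
    ∀ (x₁ x₂ x₃ : ℕ) →
    IsMinMultiplier 6 (6 * α + 2 ∷ m ∷ []) x₁ →
    IsMinMultiplier (6 * α + 2) (6 ∷ m ∷ []) x₂ →
    IsMinMultiplier m (6 ∷ 6 * α + 2 ∷ []) x₃ →
    let β₁ = 6 * x₁
        β₂ = (6 * α + 2) * x₂
        β₃ = m * x₃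
        F = Factorizations (6 ∷ 6 * α + 2 ∷ m ∷ [])
    in
      ( (Exceptional α m → β₁ ≡ 2 * m × F β₁ ≐ DoubleGenerator α m)
      × (¬ Exceptional α m → β₁ ≡ 18 * α + 6 × F β₁ ≐ TwoPoints α) )
      ×
      ( β₂ ≡ 18 * α + 6
      × (Exceptional α m → F β₂ ≐ ThreePoints α m)
      × (¬ Exceptional α m → F β₂ ≐ TwoPoints α) )
      ×
      ( β₃ ≡ 2 * m × F β₃ ≐ DoubleGenerator α m )
theorem7 α m _ odd big x₁ x₂ x₃ min₁ min₂ min₃ =
    -- In the exceptional case β₁ and β₃ are both 2m, so `F-2m` serves for each.
    ( (λ { (_ , m≤9α+3 , divides t m≡t*3) →
           at F-2m (β₁-exceptional t m≡t*3 m≤9α+3) })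
    , (λ ¬exc → at (F-18α+6 (F-3n-generic ¬exc)) (β₁-generic ¬exc)) )
  , ( β₂≡18α+6
    , (λ exc → proj₂ (at (F-18α+6 (F-3n-exceptional exc)) β₂≡18α+6))
    , (λ ¬exc → proj₂ (at (F-18α+6 (F-3n-generic ¬exc)) β₂≡18α+6)) )
  , at F-2m (trans (cong (m *_) (IsMin-unique min₃ multiplier₃)) (*-comm m 2))
  where
  open Generators α odd (subst (_< m) (second-generator α) big)

  at : ∀ {b β} {P : Pred _ 0ℓ} → F b ≐ P → β ≡ b → β ≡ b × F β ≐ P
  at F≐P refl = refl , F≐P

  -- Halving needs the element in the form 2(3n); this moves the result to the form in which the β
  -- are stated.
  F-18α+6 : ∀ {P : Pred _ 0ℓ} → F (2 * (3 * (3 * α + 1))) ≐ P → F (18 * α + 6) ≐ P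
  F-18α+6 {P} = subst (λ b → F b ≐ P) (lemma α)
    where
    lemma : ∀ α → 2 * (3 * (3 * α + 1)) ≡ 18 * α + 6
    lemma = solve-∀

  β₁-exceptional : ∀ t → m ≡ t * 3 → m ≤ 9 * α + 3 → 6 * x₁ ≡ 2 * m
  β₁-exceptional t m≡t*3 m≤9α+3 = begin
    6 * x₁      ≡⟨ cong (6 *_) (IsMin-unique min₁ (multiplier₁-exceptional t m≡t*3 m≤9α+3)) ⟩
    6 * t       ≡⟨ lemma t ⟩
    2 * (t * 3) ≡⟨ cong (2 *_) m≡t*3 ⟨
    2 * m       ∎
    where
    open ≡-Reasoning
    lemma : ∀ t → 6 * t ≡ 2 * (t * 3)
    lemma = solve-∀

  β₁-generic : ¬ Exceptional α m → 6 * x₁ ≡ 18 * α + 6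
  β₁-generic ¬exc =
    trans (cong (6 *_) (IsMin-unique min₁ (multiplier₁-generic ¬exc))) (lemma α)
    where
    lemma : ∀ α → 6 * (3 * α + 1) ≡ 18 * α + 6
    lemma = solve-∀

  β₂≡18α+6 : (6 * α + 2) * x₂ ≡ 18 * α + 6
  β₂≡18α+6 =
    trans (cong ((6 * α + 2) *_) (IsMin-unique min₂ multiplier₂)) (lemma α)
    where
    lemma : ∀ α → (6 * α + 2) * 3 ≡ 18 * α + 6
    lemma = solve-∀
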